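{- If $G$ is a finite connected graph that is $P_5$-free (i.e. no induced subgraph of $G$ is isomorphic to the five-vertex path $P_5$), then the cop number of $G$ satisfies $c(G)\le 2$.
   Context: All graphs are finite and simple. The game of cops and robbers with $s$ cops on a graph $G$: first each of the $s$ cops chooses a starting vertex, then the robber chooses a starting vertex. Then in each round, first each cop either moves to a neighbouring vertex or stays put, and then the robber either moves to a neighbouring vertex or stays put. Several cops may occupy the same vertex, and the game is played with full information. The cops win if at some point a cop is on the same vertex as the robber. The cop number $c(G)$ is the smallest $s$ such that $s$ cops have a strategy that guarantees capture of the robber on $G$. -}

module Defs where

open import Data.Nat using (ℕ; suc; _≤_)
open import Data.Fin using (Fin; toℕ)
open import Data.Product using (Σ; ∃; _×_; _,_)
open import Data.Sum using (_⊎_)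
open import Data.Empty using (⊥)
open import Relation.Nullary using (¬_)
open import Relation.Binary using (Decidable)
open import Relation.Binary.PropositionalEquality using (_≡_)
open import Function.Bundles using (_⇔_)
open import Function.Definitions using (Injective)

record Graph (n : ℕ) : Set₁ where
  field
    Adj    : Fin n → Fin n → Set
    adj?   : Decidable Adj
    sym    : ∀ {u v} → Adj u v → Adj v u
    irrefl : ∀ {u} → ¬ Adj u u
open Graph public

data Reach {n : ℕ} (G : Graph n) : Fin n → Fin n → Set where
  here : ∀ {u} → Reach G u u
  step : ∀ {u v w} → Adj G u v → Reach G v w → Reach G u w

Connected : {n : ℕ} → Graph n → Set
Connected {n} G = (u v : Fin n) → Reach G u v

P5Adj : Fin 5 → Fin 5 → Set
P5Adj i j = (suc (toℕ i) ≡ toℕ j) ⊎ (suc (toℕ j) ≡ toℕ i)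

HasInducedP5 : {n : ℕ} → Graph n → Set
HasInducedP5 {n} G =
  Σ (Fin 5 → Fin n) λ f →
    Injective _≡_ _≡_ f × (∀ i j → Adj G (f i) (f j) ⇔ P5Adj i j)

P5Free : {n : ℕ} → Graph n → Set
P5Free G = ¬ HasInducedP5 G

Move : {n : ℕ} → Graph n → Fin n → Fin n → Set
Move G u v = (u ≡ v) ⊎ Adj G u v

Caught : {n s : ℕ} → (Fin s → Fin n) → Fin n → Set
Caught {s = s} c r = ∃ λ (i : Fin s) → c i ≡ r

-- Inductively defined positions from which the cops can force capture in
-- finitely many moves (well-founded cop strategies).
mutual
  data CopWinC {n : ℕ} (G : Graph n) {s : ℕ} : (Fin s → Fin n) → Fin n → Set where
    caughtC : ∀ {c r} → Caught c r → CopWinC G c r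
    moveC   : ∀ {c r} (c' : Fin s → Fin n) → (∀ i → Move G (c i) (c' i)) →
              CopWinR G c' r → CopWinC G c r

  data CopWinR {n : ℕ} (G : Graph n) {s : ℕ} : (Fin s → Fin n) → Fin n → Set where
    caughtR : ∀ {c r} → Caught c r → CopWinR G c r
    moveR   : ∀ {c r} → (∀ r' → Move G r r' → CopWinC G c r') → CopWinR G c r

CopsWin : {n : ℕ} → Graph n → ℕ → Set
CopsWin {n} G s = Σ (Fin s → Fin n) λ c → (r : Fin n) → CopWinC G {s} c r

-- c(G) ≤ k  (c(G) is the least s with CopsWin G s)
CopNumber≤ : {n : ℕ} → Graph n → ℕ → Set
CopNumber≤ G k = ∃ λ s → s ≤ k × CopsWin G s

{-# OPTIONS --safe #-}
module Submission where

-- The cops win by induction on the number of vertices.  If D is a set of vertices whose outer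
-- boundary lies near a vertex p, the cops win the game in which D is contracted to p, and so may
-- assume that one of them stands on p while the robber is in D.
--
-- If G contains two edges u ~ v and ρ ~ ρ′ with no edges between them, ρ lies in a component R,
-- and u in a component Z, of the complement of a common boundary S.  As G is P₅-free, every s in S
-- is complete to R or to Z.  If one of R, Z is complete to all of S, contract it.  Otherwise cops
-- in R and in Z guard S and, after a further contraction, one of them can step into S so as to
-- catch the robber.
--
-- If there are no two such edges, suppose N[c] ⊆ N[p] ∪ N[q] for an edge p ~ q avoiding c.  The
-- cops win on G - c, so the robber must step to c; there any edge not near c holds him, and the
-- cops slide from such an edge to p ~ q.  Assuming also that such c do not exist, that no vertex
-- dominates another, and that no two vertices dominate G, one finds that G has no edge at all.

open import Defs
open import Data.Nat using (ℕ; zero; suc; _<_; _≤_; z≤n; s≤s)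
open import Data.Nat.Properties using (≤-refl; ≤-trans; m≤n⇒m≤1+n; n<1+n; ≤-pred)
open import Data.Bool.Properties using (T-irrelevant)
open import Data.Empty using (⊥; ⊥-elim)
open import Data.Fin using (Fin; zero; suc; toℕ)
import Data.Fin.Properties as Fin
import Data.Nat as ℕ
open import Data.List using (List; []; _∷_; length; filter; allFin)
open import Data.List.Membership.Propositional using (_∈_; lose)
open import Data.List.Membership.Propositional.Properties using (∈-allFin)
open import Data.List.Relation.Unary.Any using (here; there; any?; satisfied)
open import Data.Product using (Σ; ∃; _×_; _,_; proj₁; proj₂)
open import Data.Sum using (_⊎_; inj₁; inj₂; [_,_]′)
open import Data.Unit using (⊤; tt)
open import Function using (_∘_)
open import Function.Bundles using (_⇔_; mk⇔; Equivalence)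
open Equivalence using (to; from)
open import Relation.Binary using (Decidable; DecidableEquality)
open import Relation.Binary.PropositionalEquality using (_≡_; _≢_; refl; cong; subst)
  renaming (sym to ≡-sym)
open import Relation.Nullary using (¬_; Dec; yes; no)
open import Relation.Nullary.Decidable
  using (True; toWitness; fromWitness; map′; ¬?; _×-dec_; _⊎-dec_; decidable-stable)
import Relation.Unary as U

-- Finite graphs and counting

record FinGraph : Set₁ where
  infix 4 _~_ _~?_ _≟_
  field
    V        : Set
    _~_      : V → V → Set
    _~?_     : Decidable _~_
    ~-sym    : ∀ {u v} → u ~ v → v ~ u
    ~-irrefl : ∀ {u} → ¬ u ~ u
    _≟_      : DecidableEquality V
    vertices : List V
    complete : ∀ v → v ∈ vertices

module _ {A : Set} where

  count : {P : A → Set} → U.Decidable P → List A → ℕ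
  count P? xs = length (filter P? xs)

  count-≤ : {P Q : A → Set} (P? : U.Decidable P) (Q? : U.Decidable Q) →
            (∀ {x} → P x → Q x) → ∀ xs → count P? xs ≤ count Q? xs
  count-≤ P? Q? P⊆Q [] = z≤n
  count-≤ P? Q? P⊆Q (x ∷ xs) with P? x | Q? x
  ... | yes _ | yes _  = s≤s (count-≤ P? Q? P⊆Q xs)
  ... | yes p | no ¬q  = ⊥-elim (¬q (P⊆Q p))
  ... | no _  | yes _  = m≤n⇒m≤1+n (count-≤ P? Q? P⊆Q xs)
  ... | no _  | no _   = count-≤ P? Q? P⊆Q xs

  count-< : {P Q : A → Set} (P? : U.Decidable P) (Q? : U.Decidable Q) →
            (∀ {x} → P x → Q x) → ∀ {y xs} → y ∈ xs → Q y → ¬ P y →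
            count P? xs < count Q? xs
  count-< P? Q? P⊆Q {xs = x ∷ xs} (here refl) q ¬p with P? x | Q? x
  ... | yes p | _     = ⊥-elim (¬p p)
  ... | no _  | yes _ = s≤s (count-≤ P? Q? P⊆Q xs)
  ... | no _  | no ¬q = ⊥-elim (¬q q)
  count-< P? Q? P⊆Q {xs = x ∷ xs} (there y∈) q ¬p with P? x | Q? x
  ... | yes _ | yes _  = s≤s (count-< P? Q? P⊆Q y∈ q ¬p)
  ... | yes p | no ¬q  = ⊥-elim (¬q (P⊆Q p))
  ... | no _  | yes _  = m≤n⇒m≤1+n (count-< P? Q? P⊆Q y∈ q ¬p)
  ... | no _  | no _   = count-< P? Q? P⊆Q y∈ q ¬p

-- Walks, components and the two-cop game

module Basics (Γ : FinGraph) where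
  open FinGraph Γ public

  Near : V → V → Set
  Near u v = u ≡ v ⊎ u ~ v

  near? : Decidable Near
  near? u v = (u ≟ v) ⊎-dec (u ~? v)

  near-sym : ∀ {u v} → Near u v → Near v u
  near-sym (inj₁ refl) = inj₁ refl
  near-sym (inj₂ e)    = inj₂ (~-sym e)

  abstract
    search : {P : V → Set} → U.Decidable P → Dec (∃ P)
    search P? with any? P? vertices
    ... | yes a = yes (satisfied a)
    ... | no ¬a = no λ (v , p) → ¬a (lose (complete v) p)

  -- The ten conditions force the five vertices to be distinct, since no two vertices of the path
  -- have the same neighbours.
  P₅-free : Set
  P₅-free = ∀ a b c d e → a ~ b → b ~ c → c ~ d → d ~ e →
            ¬ a ~ c → ¬ a ~ d → ¬ a ~ e → ¬ b ~ d → ¬ b ~ e → ¬ c ~ e → ⊥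

  data Walk (Q : V → Set) : V → V → Set where
    stop : ∀ {u} → Q u → Walk Q u u
    step : ∀ {u v w} → Q u → u ~ v → Walk Q v w → Walk Q u w

  Everywhere : V → Set
  Everywhere _ = ⊤

  Conn : (V → Set) → Set
  Conn Q = ∀ {u v} → Q u → Q v → Walk Q u v

  source : ∀ {Q u v} → Walk Q u v → Q u
  source (stop q)     = q
  source (step q _ _) = q

  infixr 5 _++ʷ_
  _++ʷ_ : ∀ {Q u v w} → Walk Q u v → Walk Q v w → Walk Q u w
  stop _      ++ʷ w′ = w′
  step q e w  ++ʷ w′ = step q e (w ++ʷ w′)

  reverse : ∀ {Q u v} → Walk Q u v → Walk Q v u
  reverse (stop q)     = stop q
  reverse (step q e w) = reverse w ++ʷ step (source w) (~-sym e) (stop q)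

  map-walk : ∀ {Q Q′ : V → Set} {u v} → (∀ {x} → Q x → Q′ x) → Walk Q u v → Walk Q′ u v
  map-walk f (stop q)     = stop (f q)
  map-walk f (step q e w) = step (f q) e (map-walk f w)

  exit : ∀ {Q C : V → Set} {u v} → U.Decidable C → Walk Q u v → C u → ¬ C v →
         ∃ λ x → ∃ λ y → Q x × Q y × C x × ¬ C y × x ~ y
  exit C? (stop _) c ¬c = ⊥-elim (¬c c)
  exit C? (step {v = v} q e w) c ¬c with C? v
  ... | yes c′ = exit C? w c′ ¬c
  ... | no ¬c′ = _ , v , q , source w , c , ¬c′ , e

  walk-closed : ∀ {Q C : V → Set} {u v} → (∀ {x y} → C x → Q y → x ~ y → C y) →
                Walk Q u v → C u → C v
  walk-closed closed (stop _)     c = c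
  walk-closed closed (step _ e w) c = walk-closed closed w (closed c (source w) e)

  record Component (X : V → Set) (r : V) : Set₁ where
    field
      C         : V → Set
      C?        : U.Decidable C
      within    : ∀ {x} → C x → X x
      root      : C r
      closed    : ∀ {x y} → C x → X y → x ~ y → C y
      connected : Conn C

  abstract
    component : ∀ {X : V → Set} → U.Decidable X → ∀ {r} → X r → Component X r
    component {X} X? {r} Xr =
      grow _ (λ v → v ≟ r) (n<1+n _) (λ { refl → Xr }) refl (λ { refl → stop refl })
      where
      grow : ∀ m {C : V → Set} (C? : U.Decidable C) →
             count (λ v → ¬? (C? v)) vertices < m →
             (∀ {x} → C x → X x) → C r → (∀ {x} → C x → Walk C r x) → Component X r
      grow (suc m) {C} C? small C⊆X Cr conn
        with search (λ v → X? v ×-dec ¬? (C? v) ×-dec search (λ c → C? c ×-dec c ~? v))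
      ... | no none = record
        { C = C ; C? = C? ; within = C⊆X ; root = Cr
        ; closed = λ {x} {y} Cx Xy e → decidable-stable (C? y) λ ¬Cy → none (y , Xy , ¬Cy , x , Cx , e)
        ; connected = λ Cu Cv → reverse (conn Cu) ++ʷ conn Cv }
      ... | yes (v , Xv , ¬Cv , c , Cc , e) =
        grow m {λ x → C x ⊎ x ≡ v} (λ x → C? x ⊎-dec x ≟ v)
          (≤-trans (count-< (λ x → ¬? (C? x ⊎-dec x ≟ v)) (λ x → ¬? (C? x)) (λ ¬C′ Cx → ¬C′ (inj₁ Cx))
                            (complete v) ¬Cv (λ ¬C′ → ¬C′ (inj₂ refl)))
                   (≤-pred small))
          [ C⊆X , (λ { refl → Xv }) ]′ (inj₁ Cr)
          [ (λ Cx → map-walk inj₁ (conn Cx))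
          , (λ { refl → map-walk inj₁ (conn Cc) ++ʷ step (inj₁ Cc) e (stop (inj₂ refl)) }) ]′

  NoTwoEdges : Set
  NoTwoEdges = ∀ {a b c d} → a ~ b → c ~ d →
               ¬ Near a c → ¬ Near a d → ¬ Near b c → ¬ Near b d → ⊥

  NoCorner : Set
  NoCorner = ∀ {x w} → x ≢ w → ∃ λ t → x ~ t × ¬ Near w t

  -- Under `NoTwoEdges`, cops on `a ~ b` hold a robber at `o`; one move takes them to `p ~ q`, where
  -- every reply of his is near a cop.
  Trap : V → V → V → V → V → Set
  Trap o a b p q = (a ~ b × ¬ Near o a × ¬ Near o b) × (Near a p × Near b q) ×
                   (p ~ q × p ≢ o × q ≢ o) × ¬ ∃ λ t → Near o t × ¬ Near p t × ¬ Near q t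

  -- A cop near the robber on the cops' turn captures at once, so `WinC` carries the base cases and
  -- `WinR` has none.
  mutual
    data WinC (p q r : V) : Set where
      grab₁ : Near p r → WinC p q r
      grab₂ : Near q r → WinC p q r
      go    : ∀ {p′ q′} → Near p p′ → Near q q′ → WinR p′ q′ r → WinC p q r

    data WinR (p q r : V) : Set where
      wait : (∀ r′ → Near r r′ → WinC p q r′) → WinR p q r

  Win : Set
  Win = ∀ p q r → WinC p q r

  Connected′ : Set
  Connected′ = Conn Everywhere

  swapC : ∀ {p q r} → WinC p q r → WinC q p r
  swapR : ∀ {p q r} → WinR p q r → WinR q p r
  swapC (grab₁ n)  = grab₂ n
  swapC (grab₂ n)  = grab₁ n
  swapC (go m n w) = go n m (swapR w)
  swapR (wait h)   = wait λ r′ m → swapC (h r′ m)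

  -- D is the region to which the robber is confined while the second cop walks.
  walk₂ : ∀ {Q D : V → Set} {p q q′} →
          (∀ {s r r′} → Q s → D r → Near r r′ → D r′ ⊎ Near p r′ ⊎ Near s r′) →
          Walk Q q q′ → (∀ r → D r → WinC p q′ r) → ∀ r → D r → WinC p q r
  walk₂ guard (stop _)     win r Dr = win r Dr
  walk₂ guard (step _ e w) win r Dr = go (inj₁ refl) (inj₂ e) (wait λ r′ m →
    [ walk₂ guard w win r′ , [ grab₁ , grab₂ ]′ ]′ (guard (source w) Dr m))

  win-from : Connected′ → ∀ {p q} → (∀ r → WinC p q r) → Win
  win-from conn {p} {q} win p₀ q₀ r =
    walk₂ {D = Everywhere} (λ _ _ _ → inj₁ tt) (conn tt tt)
      (λ r _ → swapC (walk₂ {D = Everywhere} (λ _ _ _ → inj₁ tt) (conn tt tt)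
        (λ r _ → swapC (win r)) r tt)) r tt

  dominating-pair : Connected′ → ∀ {x y} → (∀ r → Near x r ⊎ Near y r) → Win
  dominating-pair conn dom = win-from conn λ r → [ grab₁ , grab₂ ]′ (dom r)

size : FinGraph → ℕ
size Γ = length (FinGraph.vertices Γ)

-- Induced subgraphs

module Induced (Γ : FinGraph) {P : FinGraph.V Γ → Set} (P? : U.Decidable P) where
  open Basics Γ

  -- `True` makes membership proof-irrelevant, so vertices are equal as soon as their first
  -- components are.
  Sub : Set
  Sub = Σ V λ v → True (P? v)

  sub-≡ : {x y : Sub} → proj₁ x ≡ proj₁ y → x ≡ y
  sub-≡ {x , s} {_ , t} refl = cong (x ,_) (T-irrelevant s t)

  in-sub : ∀ v → P v → Sub
  in-sub v p = v , fromWitness p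

  collect : List V → List Sub
  collect [] = []
  collect (x ∷ xs) with P? x
  ... | yes p = in-sub x p ∷ collect xs
  ... | no _  = collect xs

  collect-∈ : ∀ {y xs} → proj₁ y ∈ xs → y ∈ collect xs
  collect-∈ {y} {x ∷ _} y∈ with P? x | y∈
  ... | yes _ | here eq   = here (sub-≡ eq)
  ... | yes _ | there y∈′ = there (collect-∈ y∈′)
  ... | no ¬p | here eq   = ⊥-elim (¬p (subst P eq (toWitness (proj₂ y))))
  ... | no _  | there y∈′ = collect-∈ y∈′

  collect-≤ : ∀ xs → length (collect xs) ≤ length xs
  collect-≤ [] = z≤n
  collect-≤ (x ∷ xs) with P? x
  ... | yes _ = s≤s (collect-≤ xs)
  ... | no _  = m≤n⇒m≤1+n (collect-≤ xs)

  collect-< : ∀ {x xs} → x ∈ xs → ¬ P x → length (collect xs) < length xs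
  collect-< {x} {_ ∷ xs} (here refl) ¬p with P? x
  ... | yes p = ⊥-elim (¬p p)
  ... | no _  = s≤s (collect-≤ xs)
  collect-< {x} {y ∷ xs} (there x∈) ¬p with P? y
  ... | yes _ = s≤s (collect-< x∈ ¬p)
  ... | no _  = m≤n⇒m≤1+n (collect-< x∈ ¬p)

  induced : FinGraph
  induced = record
    { V        = Sub
    ; _~_      = λ x y → proj₁ x ~ proj₁ y
    ; _~?_     = λ x y → proj₁ x ~? proj₁ y
    ; ~-sym    = ~-sym
    ; ~-irrefl = ~-irrefl
    ; _≟_      = λ x y → map′ sub-≡ (cong proj₁) (proj₁ x ≟ proj₁ y)
    ; vertices = collect vertices
    ; complete = λ x → collect-∈ (complete (proj₁ x))
    }

  module I = Basics induced

  induced-P₅-free : P₅-free → I.P₅-free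
  induced-P₅-free p5 (a , _) (b , _) (c , _) (d , _) (e , _) = p5 a b c d e

  lower : ∀ {x y} → I.Near x y → Near (proj₁ x) (proj₁ y)
  lower (inj₁ refl) = inj₁ refl
  lower (inj₂ e)    = inj₂ e

  lift : ∀ {x y} → Near (proj₁ x) (proj₁ y) → I.Near x y
  lift (inj₁ eq) = inj₁ (sub-≡ eq)
  lift (inj₂ e)  = inj₂ e

  smaller : ∀ {v} → ¬ P v → size induced < size Γ
  smaller {v} ¬p = collect-< (complete v) ¬p

-- Retractions and contractions

module Reductions (Γ : FinGraph)
  (conn : Basics.Connected′ Γ) (p5 : Basics.P₅-free Γ)
  (ih : ∀ Δ → size Δ < size Γ → Basics.Connected′ Δ → Basics.P₅-free Δ → Basics.Win Δ) where
  open Basics Γ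

  -- The cops win on the retract against the image of the robber.
  module Retract {P : V → Set} (P? : U.Decidable P) (f : V → V) (f∈ : ∀ v → P (f v))
    (f-fix : ∀ {v} → P v → f v ≡ v) (f-near : ∀ {u v} → Near u v → Near (f u) (f v))
    (on-image : ∀ q r → f r ≢ r → WinR (f r) q r) where
    open Induced Γ P?

    image : V → Sub
    image v = in-sub (f v) (f∈ v)

    image-walk : ∀ {u v} → Walk Everywhere u v → I.Walk I.Everywhere (image u) (image v)
    image-walk (stop _) = I.stop tt
    image-walk {v = v} (step _ e w) with f-near (inj₂ e)
    ... | inj₁ eq = subst (λ x → I.Walk _ x (image v)) (≡-sym (sub-≡ eq)) (image-walk w)
    ... | inj₂ e′ = I.step tt e′ (image-walk w)

    image-fix : ∀ x → image (proj₁ x) ≡ x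
    image-fix (v , t) = sub-≡ (f-fix (toWitness t))

    induced-conn : I.Connected′
    induced-conn {x} {y} _ _ =
      subst (λ z → I.Walk _ z y) (image-fix x)
        (subst (I.Walk _ (image (proj₁ x))) (image-fix y) (image-walk (conn tt tt)))

    -- A cop reaches the robber's image: either this is the robber, or the cop steps onto it and
    -- `on-image` finishes.
    capture : ∀ {p q} r → Near p (f r) → WinC p q r
    capture r n with f r ≟ r
    ... | yes eq = grab₁ (subst (Near _) eq n)
    ... | no neq = go n (inj₁ refl) (on-image _ r neq)

    simC : ∀ {p q s} → I.WinC p q s → ∀ r → proj₁ s ≡ f r → WinC (proj₁ p) (proj₁ q) r
    simR : ∀ {p q s} → I.WinR p q s → ∀ r → proj₁ s ≡ f r → WinR (proj₁ p) (proj₁ q) r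
    simC (I.grab₁ n)  r eq = capture r (subst (Near _) eq (lower n))
    simC (I.grab₂ n)  r eq = swapC (capture r (subst (Near _) eq (lower n)))
    simC (I.go m n w) r eq = go (lower m) (lower n) (simR w r eq)
    simR (I.wait h) r eq = wait λ r′ m →
      simC (h (image r′) (lift (subst (λ x → Near x (f r′)) (≡-sym eq) (f-near m)))) r′ refl

    retract-win : ∀ {v} → ¬ P v → Win
    retract-win {v} ¬p = win-from conn λ r →
      simC (ih induced (smaller ¬p) induced-conn (induced-P₅-free p5) (image v) (image v) (image r)) r refl

  -- Sending `D` to `p` and fixing the rest preserves `Near`, because edges leaving `D` end near
  -- `p`. The retract lacks `d`, so induction applies. As `p` may lie in `D`, `P` admits it
  -- separately.
  collapse : ∀ {D : V → Set} (D? : U.Decidable D) {p d} → D d → d ≢ p →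
             (∀ {x y} → D x → ¬ D y → x ~ y → Near p y) →
             (∀ q r → D r → WinR p q r) → Win
  collapse {D} D? {p} {d} Dd d≢p border win =
    Retract.retract-win P? f f∈ f-fix f-near on-image {d} [ (λ ¬Dd → ¬Dd Dd) , d≢p ]′
    where
    P : V → Set
    P v = ¬ D v ⊎ v ≡ p
    P? : U.Decidable P
    P? v = ¬? (D? v) ⊎-dec v ≟ p
    f : V → V
    f v with D? v
    ... | yes _ = p
    ... | no _  = v
    f∈ : ∀ v → P (f v)
    f∈ v with D? v
    ... | yes _ = inj₂ refl
    ... | no ¬d = inj₁ ¬d
    f-fix : ∀ {v} → P v → f v ≡ v
    f-fix {v} Pv with D? v | Pv
    ... | yes d | inj₁ ¬d = ⊥-elim (¬d d)
    ... | yes _ | inj₂ eq = ≡-sym eq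
    ... | no _  | _       = refl
    f-near : ∀ {u v} → Near u v → Near (f u) (f v)
    f-near (inj₁ refl) = inj₁ refl
    f-near {u} {v} (inj₂ e) with D? u | D? v
    ... | yes _ | yes _ = inj₁ refl
    ... | yes d | no ¬d = border d ¬d e
    ... | no ¬d | yes d = near-sym (border d ¬d (~-sym e))
    ... | no _  | no _  = inj₂ e
    on-image : ∀ q r → f r ≢ r → WinR (f r) q r
    on-image q r neq with D? r
    ... | yes d = win q r d
    ... | no _  = ⊥-elim (neq refl)

  -- The cop on `p` guards every exit from `D`, which gives the other cop time to walk to `t`.
  collapse-to : ∀ {D : V → Set} (D? : U.Decidable D) {p d t} → D d → d ≢ p →
                (∀ {x y} → D x → ¬ D y → x ~ y → Near p y) →
                (∀ r → D r → WinC p t r) → Win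
  collapse-to {D} D? {p} Dd d≢p border win = collapse D? Dd d≢p border λ q r Dr →
    wait λ r′ m → [ walk₂ {Q = Everywhere} (λ _ → confine) (conn tt tt) win r′ , [ grab₁ , grab₂ ]′ ]′
                    (confine {q} Dr m)
    where
    confine : ∀ {s x y} → D x → Near x y → D y ⊎ Near p y ⊎ Near s y
    confine Dx (inj₁ refl) = inj₁ Dx
    confine {y = y} Dx (inj₂ e) with D? y
    ... | yes Dy = inj₁ Dy
    ... | no ¬Dy = inj₂ (inj₁ (border Dx ¬Dy e))

  collapse-near : ∀ {D : V → Set} (D? : U.Decidable D) {p d t} → D d → d ≢ p →
                  (∀ {x y} → D x → ¬ D y → x ~ y → Near p y) →
                  (∀ {x} → D x → Near t x) → Win
  collapse-near D? Dd d≢p border near-t = collapse-to D? Dd d≢p border λ _ Dr → grab₂ (near-t Dr)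

  corner : ∀ {x w} → x ≢ w → (∀ {t} → x ~ t → Near w t) → Win
  corner {x} {w} x≢w dom =
    collapse-near (_≟ x) {t = x} refl x≢w (λ { refl _ e → dom e }) (λ { refl → inj₁ refl })

  -- Separators in P₅-free graphs

  Anticomplete : (V → Set) → (V → Set) → Set
  Anticomplete X Y = ∀ {x y} → X x → Y y → ¬ x ~ y

  Incomplete : V → (V → Set) → Set
  Incomplete s X = ∃ λ x → X x × ¬ s ~ x

  abstract
    incomplete? : ∀ s {X : V → Set} → U.Decidable X → Dec (Incomplete s X)
    incomplete? s X? = search λ x → X? x ×-dec ¬? (s ~? x)

  complete-to : ∀ {s} {X : V → Set} → ¬ Incomplete s X → ∀ {x} → X x → s ~ x
  complete-to {s} ¬inc {x} Xx = decidable-stable (s ~? x) λ ≁ → ¬inc (x , Xx , ≁)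

  -- Where adjacency to `s` ends along a walk in `X` and along one in `Y`, there are edges `x₁ ~ x₂`
  -- and `y₁ ~ y₂` making `x₂ - x₁ - s - y₁ - y₂` an induced path.
  complete-to-one : ∀ {X Y : V → Set} {s x y} → Conn X → Conn Y → Anticomplete X Y →
                    X x → s ~ x → Y y → s ~ y → Incomplete s X → Incomplete s Y → ⊥
  complete-to-one {s = s} connX connY anti Xx s~x Yy s~y (_ , Xx′ , ≁x′) (_ , Yy′ , ≁y′)
    with exit (s ~?_) (connX Xx Xx′) s~x ≁x′ | exit (s ~?_) (connY Yy Yy′) s~y ≁y′
  ... | x₁ , x₂ , X₁ , X₂ , s~x₁ , s≁x₂ , x₁~x₂ | y₁ , y₂ , Y₁ , Y₂ , s~y₁ , s≁y₂ , y₁~y₂ =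
    p5 x₂ x₁ s y₁ y₂ (~-sym x₁~x₂) (~-sym s~x₁) s~y₁ y₁~y₂
       (s≁x₂ ∘ ~-sym) (anti X₂ Y₁) (anti X₂ Y₂) (anti X₁ Y₁) (anti X₁ Y₂) s≁y₂

  -- While the cops stand in X and Y they guard S.  The cop in Y jumps onto t; a robber escaping
  -- from r to s would give the induced path y₀ - s - r - t - c.
  attack : ∀ {S X Y W : V → Set} {c q y₀ y₁ t} → U.Decidable W → Conn Y →
           Anticomplete W Y → Anticomplete X Y →
           (∀ {w s} → W w → ¬ W s → w ~ s → S s) →
           (∀ {s} → S s → Incomplete s X → Incomplete s Y → ⊥) →
           X c → Y q → t ~ c → Y y₀ → ¬ t ~ y₀ → Y y₁ → t ~ y₁ → (∀ {w} → W w → t ~ w) →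
           ∀ r → W r → WinC c q r
  attack {S} {X} {Y} {W} {c} {q} {y₀} {y₁} {t} W? connY antiW antiX border split Xc Yq t~c Y₀ t≁y₀ Y₁ t~y₁ t~W =
    walk₂ guard (connY Yq Y₁) jump
    where
    guard : ∀ {s r r′} → Y s → W r → Near r r′ → W r′ ⊎ Near c r′ ⊎ Near s r′
    guard Ys Wr (inj₁ refl) = inj₁ Wr
    guard {s} {r′ = r′} Ys Wr (inj₂ e) with W? r′ | near? c r′ | near? s r′
    ... | yes W′ | _     | _     = inj₁ W′
    ... | no _   | yes n | _     = inj₂ (inj₁ n)
    ... | no _   | no _  | yes n = inj₂ (inj₂ n)
    ... | no ¬W′ | no ¬c | no ¬s =
      ⊥-elim (split (border Wr ¬W′ e) (c , Xc , ¬c ∘ inj₂ ∘ ~-sym) (s , Ys , ¬s ∘ inj₂ ∘ ~-sym))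
    jump : ∀ r → W r → WinC c y₁ r
    jump r Wr with near? c r
    ... | yes n = grab₁ n
    ... | no ¬n = go (inj₁ refl) (inj₂ (~-sym t~y₁)) (wait escape)
      where
      escape : ∀ s → Near r s → WinC c t s
      escape s (inj₁ refl) = grab₂ (inj₂ (t~W Wr))
      escape s (inj₂ e) with W? s | near? c s | near? t s
      ... | yes Ws | _     | _     = grab₂ (inj₂ (t~W Ws))
      ... | no _   | yes n | _     = grab₁ n
      ... | no _   | no _  | yes n = grab₂ n
      ... | no ¬Ws | no ¬c | no ¬t = ⊥-elim
        (p5 y₀ s r t c (~-sym s~y₀) (~-sym e) (~-sym (t~W Wr)) t~c
            (antiW Wr Y₀ ∘ ~-sym) (t≁y₀ ∘ ~-sym) (antiX Xc Y₀ ∘ ~-sym)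
            (¬t ∘ inj₂ ∘ ~-sym) (¬c ∘ inj₂ ∘ ~-sym) (¬n ∘ inj₂ ∘ ~-sym))
        where
        s~y₀ : s ~ y₀
        s~y₀ = complete-to (split (border Wr ¬Ws e) (c , Xc , ¬c ∘ inj₂ ∘ ~-sym)) Y₀

  -- Two edges with no edge between them

  module TwoEdges {u v ρ ρ′} (u~v : u ~ v) (ρ~ρ′ : ρ ~ ρ′)
    (u≁ρ : ¬ Near u ρ) (u≁ρ′ : ¬ Near u ρ′) (v≁ρ : ¬ Near v ρ) (v≁ρ′ : ¬ Near v ρ′) where

    Far : V → Set
    Far x = ¬ Near u x × ¬ Near v x

    module R = Component (component {Far} (λ x → ¬? (near? u x) ×-dec ¬? (near? v x)) {ρ} (u≁ρ , v≁ρ))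
    open R using () renaming (C to R; C? to R?)

    Bordering : V → Set
    Bordering s = ∃ λ x → R x × x ~ s

    abstract
      bordering? : U.Decidable Bordering
      bordering? s = search λ x → R? x ×-dec x ~? s

    S : V → Set
    S s = ¬ R s × Bordering s

    S? : U.Decidable S
    S? s = ¬? (R? s) ×-dec bordering? s

    not-bordering : ∀ {w} → (∀ {x} → Far x → ¬ Near w x) → ¬ R w × ¬ Bordering w
    not-bordering far = (λ Rw → far (R.within Rw) (inj₁ refl))
                      , (λ (_ , Rx , e) → far (R.within Rx) (inj₂ (~-sym e)))

    module Z = Component (component {λ s → ¬ R s × ¬ Bordering s}
                            (λ s → ¬? (R? s) ×-dec ¬? (bordering? s)) {u} (not-bordering proj₁))
    open Z using () renaming (C to Z; C? to Z?)

    Rρ′ : R ρ′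
    Rρ′ = R.closed R.root (u≁ρ′ , v≁ρ′) ρ~ρ′

    Zv : Z v
    Zv = Z.closed Z.root (not-bordering proj₂) u~v

    anti : Anticomplete R Z
    anti Rx Zy e = proj₂ (Z.within Zy) (_ , Rx , e)

    R-border : ∀ {x s} → R x → ¬ R s → x ~ s → S s
    R-border Rx ¬Rs e = ¬Rs , _ , Rx , e

    Z-border : ∀ {x s} → Z x → ¬ Z s → x ~ s → S s
    Z-border {x} {s} Zx ¬Zs e with R? s | bordering? s
    ... | yes Rs | _     = ⊥-elim (anti Rs Zx (~-sym e))
    ... | no ¬Rs | yes b = ¬Rs , b
    ... | no ¬Rs | no ¬b = ⊥-elim (¬Zs (Z.closed Zx (¬Rs , ¬b) e))

    R∩S : ∀ {x} → R x → ¬ S x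
    R∩S Rx (¬Rx , _) = ¬Rx Rx

    Z∩S : ∀ {x} → Z x → ¬ S x
    Z∩S Zx (_ , b) = proj₂ (Z.within Zx) b

    S-meets-R : ∀ {s} → S s → ∃ λ x → R x × s ~ x
    S-meets-R (_ , x , Rx , e) = x , Rx , ~-sym e

    -- A boundary vertex of `R` near neither `u` nor `v` would belong to `R`; so `s` is adjacent to
    -- `u` or `v`, and both lie in `Z`.
    S-meets-Z : ∀ {s} → S s → ∃ λ x → Z x × s ~ x
    S-meets-Z {s} Ss@(¬Rs , x , Rx , e) with near? u s | near? v s
    ... | yes (inj₁ refl) | _               = ⊥-elim (Z∩S Z.root Ss)
    ... | yes (inj₂ u~s)  | _               = u , Z.root , ~-sym u~s
    ... | no _            | yes (inj₁ refl) = ⊥-elim (Z∩S Zv Ss)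
    ... | no _            | yes (inj₂ v~s)  = v , Zv , ~-sym v~s
    ... | no ¬u           | no ¬v           = ⊥-elim (¬Rs (R.closed Rx (¬u , ¬v) e))

    split : ∀ {s} → S s → Incomplete s R → Incomplete s Z → ⊥
    split Ss with S-meets-R Ss | S-meets-Z Ss
    ... | _ , Rx , s~x | _ , Zy , s~y = complete-to-one R.connected Z.connected anti Rx s~x Zy s~y

    split′ : ∀ {s} → S s → Incomplete s Z → Incomplete s R → ⊥
    split′ Ss iZ iR = split Ss iR iZ

    -- `R` contracts to `ρ`, and any vertex `t` of `S` dominates `R`; such a `t` is met on a walk
    -- from `ρ` to `u`.
    R-module : (∀ {s} → S s → ¬ Incomplete s R) → Win
    R-module full with exit R? (conn {ρ} {u} tt tt) R.root (proj₁ (Z.within Z.root))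
    ... | _ , t , _ , _ , Rx , ¬Rt , e =
      collapse-near R? {ρ} {ρ′} {t} Rρ′ (λ { refl → ~-irrefl ρ~ρ′ })
        (λ Rx ¬Ry e → inj₂ (~-sym (complete-to (full (R-border Rx ¬Ry e)) R.root)))
        (λ Ry → inj₂ (complete-to (full (R-border Rx ¬Rt e)) Ry))

    Z-module : (∀ {s} → S s → ¬ Incomplete s Z) → ∃ S → Win
    Z-module full (t , St) =
      collapse-near Z? {u} {v} {t} Zv (λ { refl → ~-irrefl u~v })
        (λ Zx ¬Zy e → inj₂ (~-sym (complete-to (full (Z-border Zx ¬Zy e)) Z.root)))
        (λ Zx → inj₂ (complete-to (full St) Zx))

    module Separated {s₁ s₂} (S₁ : S s₁) (s₁≁R : Incomplete s₁ R) (S₂ : S s₂) (s₂≁Z : Incomplete s₂ Z) where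

      -- At these vertices neither `strike-R` nor `strike-Z` applies. The boundary of `C` consists
      -- of such vertices, and they are adjacent to `ρ`, so `C` contracts to `ρ`.
      Full : V → Set
      Full s = S s × ¬ Incomplete s R × ¬ Incomplete s Z

      abstract
        full? : U.Decidable Full
        full? s = S? s ×-dec ¬? (incomplete? s R?) ×-dec ¬? (incomplete? s Z?)

      module C = Component (component {λ s → ¬ Full s} (λ s → ¬? (full? s)) {ρ} (λ (Sρ , _) → R∩S R.root Sρ))
      open C using (C; C?)

      C-border : ∀ {x s} → C x → ¬ C s → x ~ s → Near ρ s
      C-border {s = s} Cx ¬Cs e with full? s
      ... | yes (_ , full , _) = inj₂ (~-sym (complete-to full R.root))
      ... | no ¬full           = ⊥-elim (¬Cs (C.closed Cx ¬full e))

      Cρ′ : C ρ′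
      Cρ′ = C.closed C.root (λ (Sρ′ , _) → R∩S Rρ′ Sρ′) ρ~ρ′

      -- Being incomplete to `Z`, `t` is complete to `R`, which holds the cop on `ρ`, and to `W`, by
      -- `complete-to-one` for `W` and `Z`. So `attack` applies.
      strike-R : ∀ {W : V → Set} {t r} → U.Decidable W → Conn W → Anticomplete W Z →
                 (∀ {w s} → W w → ¬ W s → w ~ s → S s) →
                 S t → Incomplete t Z → ∀ {w} → W w → t ~ w → W r → WinC ρ u r
      strike-R W? connW antiW border St t≁Z@(_ , Zy₀ , t≁y₀) Ww t~w Wr with S-meets-Z St
      ... | _ , Zy , t~y =
        attack W? Z.connected antiW anti border split R.root Z.root
          (complete-to (λ inc → split St inc t≁Z) R.root) Zy₀ t≁y₀ Zy t~y
          (complete-to (λ inc → complete-to-one connW Z.connected antiW Ww t~w Zy t~y inc t≁Z)) _ Wr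

      strike-Z : ∀ {W : V → Set} {t r} → U.Decidable W → Conn W → Anticomplete W R →
                 (∀ {w s} → W w → ¬ W s → w ~ s → S s) →
                 S t → Incomplete t R → ∀ {w} → W w → t ~ w → W r → WinC ρ u r
      strike-Z W? connW antiW border St t≁R@(_ , Rx₀ , t≁x₀) Ww t~w Wr with S-meets-R St
      ... | _ , Rx , t~x =
        swapC (attack W? R.connected antiW (λ Zx Ry e → anti Ry Zx (~-sym e)) border split′ Z.root R.root
          (complete-to (λ inc → split St t≁R inc) Z.root) Rx₀ t≁x₀ Rx t~x
          (complete-to (λ inc → complete-to-one connW R.connected antiW Ww t~w Rx t~x inc t≁R)) _ Wr)

      -- The robber's component W of the complement of S differs from R and Z; since W lies in C,
      -- it has a neighbour in S that is not complete to both R and Z.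
      module Elsewhere {r} (Cr : C r) (¬Sr : ¬ S r) (¬Rr : ¬ R r) (¬Zr : ¬ Z r) where

        module W = Component (component {λ s → ¬ S s} (λ s → ¬? (S? s)) {r} ¬Sr)
        open W using () renaming (C to W; C? to W?)

        W-avoids : ∀ {X : V → Set} → U.Decidable X → (∀ {x s} → X x → ¬ X s → x ~ s → S s) →
                   ¬ X r → ∀ {w} → W w → ¬ X w
        W-avoids X? border ¬Xr Ww Xw =
          ¬Xr (walk-closed (λ {_} {y} Xx Wy e → decidable-stable (X? y) λ ¬Xy →
                              W.within Wy (border Xx ¬Xy e))
                           (W.connected Ww W.root) Xw)

        W-anti : ∀ {X : V → Set} → U.Decidable X → (∀ {x s} → X x → ¬ X s → x ~ s → S s) →
                 ¬ X r → Anticomplete W X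
        W-anti X? border ¬Xr Ww Xx e =
          W.within Ww (border Xx (W-avoids X? border ¬Xr Ww) (~-sym e))

        W-border : ∀ {w s} → W w → ¬ W s → w ~ s → S s
        W-border {s = s} Ww ¬Ws e = decidable-stable (S? s) λ ¬Ss → ¬Ws (W.closed Ww ¬Ss e)

        win : WinC ρ u r
        win with exit W? (C.connected Cr C.root) W.root (λ Wρ → W-avoids R? R-border ¬Rr Wρ R.root)
        ... | w , t , _ , Ct , Ww , ¬Wt , e with W-border Ww ¬Wt e | incomplete? t Z? | incomplete? t R?
        ...   | St | yes t≁Z | _ =
                strike-R W? W.connected (W-anti Z? Z-border ¬Zr) W-border St t≁Z Ww (~-sym e) W.root
        ...   | St | no _ | yes t≁R =
                strike-Z W? W.connected (W-anti R? R-border ¬Rr) W-border St t≁R Ww (~-sym e) W.root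
        ...   | St | no ¬Z | no ¬R = ⊥-elim (C.within Ct (St , ¬R , ¬Z))

      endgame : ∀ r → C r → WinC ρ u r
      endgame r Cr with S? r | R? r | Z? r
      ... | yes Sr | _ | _ with near? ρ r | near? u r
      ...   | yes n | _     = grab₁ n
      ...   | no _  | yes n = grab₂ n
      ...   | no ¬ρ | no ¬u = ⊥-elim (split Sr (ρ , R.root , ¬ρ ∘ inj₂ ∘ ~-sym) (u , Z.root , ¬u ∘ inj₂ ∘ ~-sym))
      -- Here `W = R`, and `s₂` serves as `t`; in the next case `W = Z`, and `s₁` does.
      endgame r Cr | no _ | yes Rr | _ with S-meets-R S₂
      ...   | _ , Rx , s₂~x = strike-R R? R.connected anti R-border S₂ s₂≁Z Rx s₂~x Rr
      endgame r Cr | no _ | no _ | yes Zr with S-meets-Z S₁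
      ...   | _ , Zx , s₁~x =
              strike-Z Z? Z.connected (λ Zx Ry e → anti Ry Zx (~-sym e)) Z-border S₁ s₁≁R Zx s₁~x Zr
      endgame r Cr | no ¬Sr | no ¬Rr | no ¬Zr = Elsewhere.win Cr ¬Sr ¬Rr ¬Zr

      win : Win
      win = collapse-to C? {ρ} {ρ′} Cρ′ (λ { refl → ~-irrefl ρ~ρ′ }) C-border endgame

    win : Win
    win with search (λ s → S? s ×-dec incomplete? s R?) | search (λ s → S? s ×-dec incomplete? s Z?)
    ... | no none | _ = R-module λ Ss inc → none (_ , Ss , inc)
    ... | yes (s₁ , S₁ , _) | no none = Z-module (λ Ss inc → none (_ , Ss , inc)) (s₁ , S₁)
    ... | yes (s₁ , S₁ , inc₁) | yes (s₂ , S₂ , inc₂) = Separated.win S₁ inc₁ S₂ inc₂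

  -- Deleting a vertex

  module Delete {o p q} (p~q : p ~ q) (p≢o : p ≢ o) (q≢o : q ≢ o)
    (dominated : ∀ {t} → Near o t → Near p t ⊎ Near q t)
    (when-at-o : ∀ x y → WinC x y o) where
    open Induced Γ {λ v → v ≢ o} (λ v → ¬? (v ≟ o))

    p̂ q̂ : Sub
    p̂ = in-sub p p≢o
    q̂ = in-sub q q≢o

    near-walk : ∀ {x y} → I.Near x y → I.Walk I.Everywhere x y
    near-walk (inj₁ refl) = I.stop tt
    near-walk (inj₂ e)    = I.step tt e (I.stop tt)

    via : ∀ x → Near p (proj₁ x) ⊎ Near q (proj₁ x) → I.Walk I.Everywhere x p̂
    via x (inj₁ n) = near-walk (lift (near-sym n))
    via x (inj₂ n) = near-walk {x} {q̂} (lift (near-sym n)) I.++ʷ I.step tt (~-sym p~q) (I.stop tt)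

    -- A vertex of the walk followed by `o` is near `p` or `q` by `dominated`, and `via` leads from
    -- it to `p` without `o`.
    reach : ∀ {x v} → v ≡ p → Walk Everywhere (proj₁ x) v → I.Walk I.Everywhere x p̂
    reach eq (stop _) = near-walk (inj₁ (sub-≡ eq))
    reach {x} eq (step {v = v} _ e w) with v ≟ o
    ... | yes refl = via x (dominated (inj₂ (~-sym e)))
    ... | no v≢o   = I.step tt e (reach {in-sub v v≢o} eq w)

    induced-conn : I.Connected′
    induced-conn _ _ = reach refl (conn tt tt) I.++ʷ I.reverse (reach refl (conn tt tt))

    simC : ∀ {x y r} → I.WinC x y r → WinC (proj₁ x) (proj₁ y) (proj₁ r)
    simR : ∀ {x y r} → I.WinR x y r → WinR (proj₁ x) (proj₁ y) (proj₁ r)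
    simC (I.grab₁ n)  = grab₁ (lower n)
    simC (I.grab₂ n)  = grab₂ (lower n)
    simC (I.go m n w) = go (lower m) (lower n) (simR w)
    simR {x} {y} (I.wait h) = wait λ r′ m → answer r′ m
      where
      answer : ∀ r′ → Near _ r′ → WinC (proj₁ x) (proj₁ y) r′
      answer r′ m with r′ ≟ o
      ... | yes refl = when-at-o _ _
      ... | no r′≢o  = simC (h (in-sub r′ r′≢o) (lift m))

    win : Win
    win = win-from conn {p} {q} from-pq
      where
      from-pq : ∀ r → WinC p q r
      from-pq r with r ≟ o
      ... | yes refl = when-at-o p q
      ... | no r≢o   =
        simC (ih induced (smaller λ o≢o → o≢o refl) induced-conn (induced-P₅-free p5) p̂ q̂ (in-sub r r≢o))

  -- By NoTwoEdges the neighbourhood of o is guarded by any edge that is not near o.  The cops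
  -- slide such an edge to a ~ b, holding the robber at o, and then jump to p ~ q.
  trap-win : NoTwoEdges → NoCorner → ∀ {o a b p q} → Trap o a b p q → Win
  trap-win noTwo noCorner {o} {a} {b} {p} {q}
    ((a~b , o≁a , o≁b) , (a-p , b-q) , (p~q , p≢o , q≢o) , none) =
    Delete.win p~q p≢o q≢o dominated when-at-o
    where
    dominated : ∀ {t} → Near o t → Near p t ⊎ Near q t
    dominated {t} n with near? p t | near? q t
    ... | yes m | _     = inj₁ m
    ... | no _  | yes m = inj₂ m
    ... | no ¬p | no ¬q = ⊥-elim (none (t , n , ¬p , ¬q))

    -- If the robber moves to `r`, the edges `o ~ r` and `x ~ y` are not separated, and since `o` is
    -- near neither end, `r` is near one.
    hold : ∀ {x y} → x ~ y → ¬ Near o x → ¬ Near o y → WinC x y o → WinR x y o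
    hold {x} {y} x~y o≁x o≁y win = wait answer
      where
      answer : ∀ r → Near o r → WinC x y r
      answer r (inj₁ refl) = win
      answer r (inj₂ e) with near? x r | near? y r
      ... | yes n | _     = grab₁ n
      ... | no _  | yes n = grab₂ n
      ... | no ¬x | no ¬y = ⊥-elim (noTwo e x~y o≁x o≁y (¬x ∘ near-sym) (¬y ∘ near-sym))

    jump : WinC a b o
    jump = go a-p b-q (wait λ t n → [ grab₁ , grab₂ ]′ (dominated n))

    -- The cops move one behind the other along `y - x - a - b`, so after each move they still
    -- occupy an edge not near `o`.
    slide : ∀ {a b x y} → a ~ b → ¬ Near o a → ¬ Near o b → WinC a b o →
            x ~ y → ¬ Near o x → Near x a → WinC x y o
    slide a~b o≁a o≁b win x~y o≁x (inj₁ refl) =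
      go (inj₂ a~b) (inj₂ (~-sym x~y)) (hold (~-sym a~b) o≁b o≁a (swapC win))
    slide a~b o≁a o≁b win x~y o≁x (inj₂ x~a) =
      go (inj₂ x~a) (inj₂ (~-sym x~y)) (hold (~-sym x~a) o≁a o≁x
        (slide a~b o≁a o≁b win (~-sym x~a) o≁a (inj₁ refl)))

    from-edge : ∀ {x y} → x ~ y → ¬ Near o x → ¬ Near o y → WinC x y o
    from-edge {x} {y} x~y o≁x o≁y with near? x a | near? x b | near? y a | near? y b
    ... | yes n | _ | _ | _ = slide a~b o≁a o≁b jump x~y o≁x n
    ... | _ | yes n | _ | _ = slide (~-sym a~b) o≁b o≁a (swapC jump) x~y o≁x n
    ... | _ | _ | yes n | _ = swapC (slide a~b o≁a o≁b jump (~-sym x~y) o≁y n)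
    ... | _ | _ | _ | yes n = swapC (slide (~-sym a~b) o≁b o≁a (swapC jump) (~-sym x~y) o≁y n)
    ... | no xa | no xb | no ya | no yb = ⊥-elim (noTwo x~y a~b xa xb ya yb)

    hold-edge : ∀ {x y} → x ~ y → ¬ Near o x → ¬ Near o y → WinR x y o
    hold-edge e o≁x o≁y = hold e o≁x o≁y (from-edge e o≁x o≁y)

    -- The edges `x ~ x′` and `y ~ y′` meet or are joined, so at most one move brings the cops to an
    -- edge not near `o`.
    join : ∀ {x y x′ y′} → x ~ x′ → y ~ y′ → ¬ Near o x → ¬ Near o y → ¬ Near o x′ → ¬ Near o y′ →
           WinC x y o
    join {x} {y} {x′} {y′} x~x′ y~y′ o≁x o≁y o≁x′ o≁y′
      with near? x y | near? x y′ | near? x′ y | near? x′ y′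
    ... | yes (inj₁ refl) | _ | _ | _ = go (inj₁ refl) (inj₂ y~y′) (hold-edge y~y′ o≁x o≁y′)
    ... | yes (inj₂ e) | _ | _ | _    = from-edge e o≁x o≁y
    ... | _ | yes (inj₁ refl) | _ | _ = from-edge (~-sym y~y′) o≁x o≁y
    ... | _ | yes (inj₂ e) | _ | _    = go (inj₁ refl) (inj₂ y~y′) (hold-edge e o≁x o≁y′)
    ... | _ | _ | yes (inj₁ refl) | _ = from-edge x~x′ o≁x o≁y
    ... | _ | _ | yes (inj₂ e) | _    = go (inj₂ x~x′) (inj₁ refl) (hold-edge e o≁x′ o≁y)
    ... | _ | _ | _ | yes (inj₁ refl) = go (inj₂ x~x′) (inj₁ refl) (hold-edge (~-sym y~y′) o≁x′ o≁y)
    ... | _ | _ | _ | yes (inj₂ e)    = go (inj₂ x~x′) (inj₂ y~y′) (hold-edge e o≁x′ o≁y′)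
    ... | no xy | no xy′ | no x′y | no x′y′ = ⊥-elim (noTwo x~x′ y~y′ xy xy′ x′y x′y′)

    when-at-o : ∀ x y → WinC x y o
    when-at-o x y with near? x o | near? y o
    ... | yes n | _     = grab₁ n
    ... | no _  | yes n = grab₂ n
    ... | no ¬x | no ¬y with noCorner (¬x ∘ inj₁) | noCorner (¬y ∘ inj₁)
    ...   | _ , x~x′ , o≁x′ | _ , y~y′ , o≁y′ = join x~x′ y~y′ (¬x ∘ near-sym) (¬y ∘ near-sym) o≁x′ o≁y′

-- Graphs to which no reduction applies

module Dense (Γ : FinGraph) (noTwo : Basics.NoTwoEdges Γ) (noCorner : Basics.NoCorner Γ)
  (noPair : ∀ x y → ∃ λ r → ¬ Basics.Near Γ x r × ¬ Basics.Near Γ y r)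
  (noTrap : ∀ {o a b p q} → ¬ Basics.Trap Γ o a b p q) where
  open Basics Γ

  Out : V → V → V → Set
  Out x y s = ¬ Near x s × ¬ Near y s

  out? : ∀ x y → U.Decidable (Out x y)
  out? x y s = ¬? (near? x s) ×-dec ¬? (near? y s)

  stable : ∀ {x y s t} → x ~ y → Out x y s → Out x y t → ¬ s ~ t
  stable x~y (xs , ys) (xt , yt) s~t = noTwo x~y s~t xs xt ys yt

  -- Otherwise `y ~ x` covers the closed neighbourhood of `w`. As `w` does not dominate `x`, there
  -- is an edge `x ~ x′` away from `w`, from which cops reach `y ~ x` in one move: a trap at `w`.
  dominate : ∀ {x y w} → x ~ y → y ~ w → ¬ Near x w → ∃ λ s → Out x y s × w ~ s
  dominate {x} {y} {w} x~y y~w ¬xw with search (λ s → out? x y s ×-dec w ~? s)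
  ... | yes found = found
  ... | no none with noCorner {x} {w} (¬xw ∘ inj₁)
  ...   | x′ , x~x′ , ¬wx′ = ⊥-elim (noTrap {w} {x} {x′} {y} {x}
          ( (x~x′ , ¬xw ∘ near-sym , ¬wx′)
          , (inj₂ x~y , inj₂ (~-sym x~x′))
          , (~-sym x~y , (λ { refl → ~-irrefl y~w }) , ¬xw ∘ inj₁)
          , λ { (_ , inj₁ refl , ¬y , _)  → ¬y (inj₂ y~w)
              ; (t , inj₂ w~t , ¬y , ¬x) → none (t , (¬x , ¬y) , w~t) } ))

  module Edge {z q} (z~q : z ~ q) where

    K : V → Set
    K = Out z q

    W : V → Set
    W x = ∀ {k} → K k → ¬ Near x k

    K-stable : ∀ {s t} → K s → K t → ¬ s ~ t
    K-stable = stable z~q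

    meets : ∀ x → W x ⊎ ∃ λ k → K k × Near x k
    meets x with search (λ k → out? z q k ×-dec near? x k)
    ... | yes found = inj₂ found
    ... | no none   = inj₁ λ Kk n → none (_ , Kk , n)

    z∈W : W z
    z∈W = proj₁

    q∈W : W q
    q∈W = proj₂

    -- Adjacent to only one end of `z ~ q`, `x` would by `dominate` have a neighbour in `K`; near
    -- neither end, it would lie in `K`.
    W-joined : ∀ {x} → W x → x ≢ z → x ≢ q → x ~ z × x ~ q
    W-joined {x} Wx x≢z x≢q with near? z x | near? q x
    ... | yes (inj₁ refl) | _ = ⊥-elim (x≢z refl)
    ... | _ | yes (inj₁ refl) = ⊥-elim (x≢q refl)
    ... | yes (inj₂ z~x) | yes (inj₂ q~x) = ~-sym z~x , ~-sym q~x
    ... | no ¬z | no ¬q = ⊥-elim (Wx (¬z , ¬q) (inj₁ refl))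
    ... | yes (inj₂ z~x) | no ¬q with dominate (~-sym z~q) z~x ¬q
    ...   | _ , (qs , zs) , x~s = ⊥-elim (Wx (zs , qs) (inj₂ x~s))
    W-joined {x} Wx x≢z x≢q | no ¬z | yes (inj₂ q~x) with dominate z~q q~x ¬z
    ...   | _ , Ks , x~s = ⊥-elim (Wx Ks (inj₂ x~s))

    W-clique : ∀ {x y} → W x → W y → x ≢ y → x ~ y
    W-clique {x} {y} Wx Wy x≢y with x ≟ z | x ≟ q | y ≟ z | y ≟ q
    ... | yes refl | _ | yes refl | _ = ⊥-elim (x≢y refl)
    ... | yes refl | _ | _ | yes refl = z~q
    ... | yes refl | _ | no y≢z | no y≢q = ~-sym (proj₁ (W-joined Wy y≢z y≢q))
    ... | _ | yes refl | yes refl | _ = ~-sym z~q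
    ... | _ | yes refl | _ | yes refl = ⊥-elim (x≢y refl)
    ... | _ | yes refl | no y≢z | no y≢q = ~-sym (proj₂ (W-joined Wy y≢z y≢q))
    ... | no x≢z | no x≢q | yes refl | _ = proj₁ (W-joined Wx x≢z x≢q)
    ... | no x≢z | no x≢q | _ | yes refl = proj₂ (W-joined Wx x≢z x≢q)
    ... | no x≢z | no x≢q | no y≢z | no y≢q with near? x y
    ...   | yes (inj₁ eq)  = ⊥-elim (x≢y eq)
    ...   | yes (inj₂ x~y) = x~y
    ...   | no ¬xy with W-joined Wx x≢z x≢q | W-joined Wy y≢z y≢q
    -- The vertex `s` must see `q`, and then has a neighbour `t` in `K`; but `s ~ t` is an edge
    -- outside `x ~ z`.
    ...     | x~z , _ | y~z , _ with dominate x~z (~-sym y~z) ¬xy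
    ...       | s , (xs , zs) , y~s with near? q s
    ...         | no ¬qs = ⊥-elim (Wy (zs , ¬qs) (inj₂ y~s))
    ...         | yes (inj₁ refl) = ⊥-elim (zs (inj₂ z~q))
    ...         | yes (inj₂ q~s) with dominate z~q q~s zs
    ...           | _ , Kt , s~t = ⊥-elim (stable x~z (xs , zs) (Wx Kt , proj₁ Kt) s~t)

    -- A neighbour of some `k` in `K` would form with `k` an edge outside `x ~ y`, and a vertex of
    -- `W` would be near `x`. So every edge in `W` can stand in for `z ~ q`.
    W-out : ∀ {x y s} → W x → W y → x ≢ y → Out x y s → K s
    W-out {x} {y} {s} Wx Wy x≢y (xs , ys) with meets s
    ... | inj₂ (_ , Kk , inj₁ refl) = Kk
    ... | inj₂ (_ , Kk , inj₂ s~k)  = ⊥-elim (stable (W-clique Wx Wy x≢y) (xs , ys) (Wx Kk , Wy Kk) s~k)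
    ... | inj₁ Ws = ⊥-elim (xs (inj₂ (W-clique Wx Ws (xs ∘ inj₁))))

    module Private {k} (Kk : K k) where

      Private : V → Set
      Private u = u ~ k × (∀ {k′} → K k′ → u ~ k′ → k′ ≡ k)

      K-apart : ∀ {k′} → K k′ → k′ ≢ k → ¬ Near k k′
      K-apart Kk′ ≢k (inj₁ eq) = ≢k (≡-sym eq)
      K-apart Kk′ ≢k (inj₂ e)  = K-stable Kk Kk′ e

      apart : ∀ {u} → Private u → ∀ {k′} → K k′ → k′ ≢ k → ¬ Near u k′
      apart (u~k , _)   Ku  _   (inj₁ refl) = K-stable Ku Kk u~k
      apart (_ , only) Kk′ ≢k (inj₂ u~k′) = ≢k (only Kk′ u~k′)

      W-off : ∀ {w} → W w → ¬ Near k w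
      W-off Ww = Ww Kk ∘ near-sym

      -- Among the neighbours of `k`, one with fewest neighbours in `K` works: if such a `u` also
      -- saw `k′`, then `dominate` would give a neighbour `s` of `k` that loses `k′` and gains
      -- nothing, as a gain would be an edge outside `u ~ k′`.
      private-neighbour : ∃ Private
      private-neighbour with noCorner {k} {z} (λ { refl → proj₁ Kk (inj₁ refl) })
      ... | u₀ , k~u₀ , _ = descend _ u₀ (~-sym k~u₀) (n<1+n _)
        where
        descend : ∀ m u → u ~ k → count (λ s → out? z q s ×-dec u ~? s) vertices < m → ∃ Private
        descend (suc m) u u~k small
          with search (λ k′ → out? z q k′ ×-dec u ~? k′ ×-dec ¬? (k′ ≟ k))
        ... | no none = u , u~k , λ {k′} Kk′ e → decidable-stable (k′ ≟ k) λ ne → none (k′ , Kk′ , e , ne)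
        ... | yes (k′ , Kk′ , u~k′ , k′≢k) with dominate (~-sym u~k′) u~k (K-apart Kk′ k′≢k ∘ near-sym)
        ...   | s , (k′s , us) , k~s = descend m s (~-sym k~s)
                (≤-trans (count-< (λ x → out? z q x ×-dec s ~? x) (λ x → out? z q x ×-dec u ~? x)
                                  shrink (complete k′) (Kk′ , u~k′) (λ (_ , s~k′) → k′s (inj₂ (~-sym s~k′))))
                         (≤-pred small))
          where
          shrink : ∀ {x} → K x × s ~ x → K x × u ~ x
          shrink {x} (Kx , s~x) = Kx , decidable-stable (u ~? x) λ u≁x →
            stable (~-sym u~k′) (k′s , us)
              ( (λ { (inj₁ refl) → k′s (inj₂ (~-sym s~x)) ; (inj₂ e) → K-stable Kk′ Kx e })
              , (λ { (inj₁ refl) → K-stable Kx Kk u~k ; (inj₂ e) → u≁x e })) s~x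

      out-private : ∀ {u s} → Private u → Out u k s → K s ⊎ W s
      out-private {u} {s} Pu (us , ks) with meets s
      ... | inj₁ Ws = inj₂ Ws
      ... | inj₂ (_ , Kk′ , inj₁ refl) = inj₁ Kk′
      ... | inj₂ (k′ , Kk′ , inj₂ s~k′) with k′ ≟ k
      ...   | yes refl = ⊥-elim (ks (inj₂ (~-sym s~k′)))
      ...   | no k′≢k  = ⊥-elim (stable (proj₁ Pu) (us , ks) (apart Pu Kk′ k′≢k , K-apart Kk′ k′≢k) s~k′)

      missed-by : ∀ {u x} → Private u → W x → u ~ x → ∃ λ w → W w × ¬ Near u w
      missed-by Pu Wx u~x with dominate (~-sym (proj₁ Pu)) u~x (W-off Wx)
      ... | s , (ks , us) , x~s with out-private Pu (us , ks)
      ...   | inj₁ Ks = ⊥-elim (Wx Ks (inj₂ x~s))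
      ...   | inj₂ Ws = s , Ws , us

      -- By `missed-unique`, a private neighbour then sees all of `W` but one vertex. It sees `z` or
      -- `q`, since otherwise it and `k` would be adjacent in `K`.
      missed : ∀ {u} → Private u → ∃ λ w → W w × ¬ Near u w
      missed {u} Pu with near? z u | near? q u
      ... | yes (inj₁ refl) | _ = ⊥-elim (proj₁ Kk (inj₂ (proj₁ Pu)))
      ... | yes (inj₂ z~u) | _  = missed-by Pu z∈W (~-sym z~u)
      ... | _ | yes (inj₁ refl) = ⊥-elim (proj₂ Kk (inj₂ (proj₁ Pu)))
      ... | _ | yes (inj₂ q~u)  = missed-by Pu q∈W (~-sym q~u)
      ... | no ¬z | no ¬q       = ⊥-elim (K-stable (¬z , ¬q) Kk (proj₁ Pu))

      missed-unique : ∀ {u w w′} → Private u → W w → W w′ → ¬ Near u w → ¬ Near u w′ → w′ ≡ w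
      missed-unique {w = w} {w′} Pu Ww Ww′ uw uw′ = decidable-stable (w′ ≟ w) λ ne →
        stable (proj₁ Pu) (uw′ , W-off Ww′) (uw , W-off Ww) (W-clique Ww′ Ww ne)

      sees : ∀ {u w w′} → Private u → W w → ¬ Near u w → W w′ → w′ ≢ w → u ~ w′
      sees {u} {w} {w′} Pu Ww uw Ww′ w′≢w with near? u w′
      ... | yes (inj₁ refl) = ⊥-elim (Ww′ Kk (inj₂ (proj₁ Pu)))
      ... | yes (inj₂ e)    = e
      ... | no uw′          = ⊥-elim (w′≢w (missed-unique Pu Ww Ww′ uw uw′))

      -- Otherwise `u′` has a neighbour `s` outside `u ~ k`, which lies in `K` or `W`. In `K` it
      -- would be `k`, and in `W` it would be `w`, which `u′` misses.
      same-missed : ∀ {u u′ w} → Private u → Private u′ → W w → ¬ Near u w → ¬ Near u′ w → u ≢ u′ → u ~ u′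
      same-missed {u} {u′} Pu (u′~k , only) Ww uw u′w u≢u′ with near? u u′
      ... | yes (inj₁ eq) = ⊥-elim (u≢u′ eq)
      ... | yes (inj₂ e)  = e
      ... | no uu′ with dominate (proj₁ Pu) (~-sym u′~k) uu′
      ...   | s , (us , ks) , u′~s with out-private Pu (us , ks)
      ...     | inj₁ Ks = ⊥-elim (ks (inj₁ (≡-sym (only Ks u′~s))))
      ...     | inj₂ Ws with missed-unique Pu Ww Ws uw us
      ...       | refl = ⊥-elim (u′w (inj₂ u′~s))

      out-is-private : ∀ {u w s} → Private u → W w → u ~ w → Out u w s → ¬ K s → Private s
      out-is-private {u} {w} {s} Pu Ww u~w (us , ws) ¬Ks with meets s
      ... | inj₁ Ws = ⊥-elim (ws (inj₂ (W-clique Ww Ws (ws ∘ inj₁))))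
      ... | inj₂ (_ , Ks , inj₁ refl) = ⊥-elim (¬Ks Ks)
      ... | inj₂ (k′ , Kk′ , inj₂ s~k′) = subst (s ~_) (only Kk′ s~k′) s~k′ , only
        where
        only : ∀ {k″} → K k″ → s ~ k″ → k″ ≡ k
        only {k″} Kk″ s~k″ = decidable-stable (k″ ≟ k) λ ne →
          stable u~w (us , ws) (apart Pu Kk″ ne , Ww Kk″) s~k″

      -- `dominate` at `u ~ w′ ~ w` gives the vertex; it sees `w`, so it is not in `K` and hence
      -- private.
      switch : ∀ {u w w′} → Private u → W w → ¬ Near u w → W w′ → w′ ≢ w →
               ∃ λ u′ → Private u′ × ¬ Near u′ w′ × ¬ Near u u′
      switch Pu Ww uw Ww′ w′≢w with sees Pu Ww uw Ww′ w′≢w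
      ... | u~w′ with dominate u~w′ (W-clique Ww′ Ww w′≢w) uw
      ...   | s , (us , w′s) , w~s =
            s , out-is-private Pu Ww′ u~w′ (us , w′s) (λ Ks → Ww Ks (inj₂ w~s)) , w′s ∘ near-sym , us

      no-three : ∀ {u₁ w₁ w₂ w₃} → Private u₁ → W w₁ → ¬ Near u₁ w₁ → W w₂ → W w₃ →
                 w₂ ≢ w₁ → w₃ ≢ w₁ → w₂ ≢ w₃ → ⊥
      no-three {u₁} {w₁} {w₂} {w₃} P₁ W₁ ¬u₁w₁ W₂ W₃ 2≢1 3≢1 2≢3
        with switch P₁ W₁ ¬u₁w₁ W₂ 2≢1 | switch P₁ W₁ ¬u₁w₁ W₃ 3≢1
      ... | u₂ , P₂ , ¬u₂w₂ , ¬u₁u₂ | u₃ , P₃ , ¬u₃w₃ , ¬u₁u₃ with switch P₂ W₂ ¬u₂w₂ W₃ (2≢3 ∘ ≡-sym)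
      ...   | v₃ , Q₃ , ¬v₃w₃ , ¬u₂v₃ with u₃ ≟ v₃
      -- Two private neighbours missing `w₃` are adjacent. Cops on them reach `w₁ ~ w₂` in one move,
      -- and what that edge leaves uncovered lies in `K`, away from `w₃`: a trap.
      ...     | no u₃≢v₃ = noTrap {w₃} {u₃} {v₃} {w₁} {w₂}
                ( (same-missed P₃ Q₃ W₃ ¬u₃w₃ ¬v₃w₃ u₃≢v₃ , ¬u₃w₃ ∘ near-sym , ¬v₃w₃ ∘ near-sym)
                , ( inj₂ (sees P₃ W₃ ¬u₃w₃ W₁ (3≢1 ∘ ≡-sym)) , inj₂ (sees Q₃ W₃ ¬v₃w₃ W₂ 2≢3) )
                , (W-clique W₁ W₂ (2≢1 ∘ ≡-sym) , 3≢1 ∘ ≡-sym , 2≢3)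
                , λ (_ , n , ¬1 , ¬2) → W₃ (W-out W₁ W₂ (2≢1 ∘ ≡-sym) (¬1 , ¬2)) n )
      -- Now `u₁`, `u₂`, `u₃` are pairwise nonadjacent. A neighbour `s` of `u₃` outside `u₁ ~ w₂` is
      -- private and misses `w₂` as `u₂` does, so `s ~ u₂` is an edge outside `u₁ ~ w₂`.
      ...     | yes refl with sees P₁ W₁ ¬u₁w₁ W₂ 2≢1
      ...       | u₁~w₂ with dominate u₁~w₂ (~-sym (sees P₃ W₃ ¬u₃w₃ W₂ 2≢3)) ¬u₁u₃
      ...         | s , (¬u₁s , ¬w₂s) , u₃~s =
        stable u₁~w₂ (¬u₁s , ¬w₂s) (¬u₁u₂ , ¬u₂w₂ ∘ near-sym)
          (same-missed Ps P₂ W₂ (¬w₂s ∘ near-sym) ¬u₂w₂ (λ { refl → ¬u₂v₃ (inj₂ (~-sym u₃~s)) }))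
        where
        Ps : Private s
        Ps = out-is-private P₁ W₂ u₁~w₂ (¬u₁s , ¬w₂s)
          (λ Ks → ¬u₁s (inj₂ (subst (u₁ ~_) (≡-sym (proj₂ P₃ Ks u₃~s)) (proj₁ P₁))))

    W-only : ∀ {x} → W x → x ≡ z ⊎ x ≡ q
    W-only {x} Wx with x ≟ z | x ≟ q
    ... | yes eq | _     = inj₁ eq
    ... | _      | yes eq = inj₂ eq
    ... | no x≢z | no x≢q with noPair z q
    ...   | k , Kk = ⊥-elim absurd
      where
      open Private Kk
      z≢q : z ≢ q
      z≢q refl = ~-irrefl z~q
      absurd : ⊥
      absurd with private-neighbour
      ... | u , Pu with missed Pu
      ...   | w , Ww , uw with w ≟ z | w ≟ q
      ...     | yes refl | _     = no-three Pu Ww uw q∈W Wx (z≢q ∘ ≡-sym) x≢z (x≢q ∘ ≡-sym)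
      ...     | _ | yes refl     = no-three Pu Ww uw z∈W Wx z≢q x≢q (x≢z ∘ ≡-sym)
      ...     | no w≢z | no w≢q  = no-three Pu Ww uw z∈W q∈W (w≢z ∘ ≡-sym) (w≢q ∘ ≡-sym) z≢q

    -- Pentagons through an edge

    record Pentagon (k : V) : Set where
      field
        a b : V
        a~q : a ~ q
        b~z : b ~ z
        a~k : a ~ k
        b~k : b ~ k
        z≁a : ¬ Near z a
        q≁b : ¬ Near q b
        a≁b : ¬ Near a b
        a-only : ∀ {k′} → K k′ → a ~ k′ → k′ ≡ k
        b-only : ∀ {k′} → K k′ → b ~ k′ → k′ ≡ k

    abstract
      -- The induced cycle is `k - a - q - z - b`. Its `a` and `b` are private neighbours of `k`
      -- missing `z` and `q`: one comes from `private-neighbour`, the other from `switch`.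
      pentagon : ∀ {k} → K k → Pentagon k
      pentagon {k} Kk = result
        where
        open Private Kk
        z≢q : z ≢ q
        z≢q refl = ~-irrefl z~q
        result : Pentagon k
        result with private-neighbour
        ... | u , Pu with missed Pu
        ...   | w , Ww , uw with W-only Ww
        ...     | inj₁ refl with switch Pu Ww uw q∈W (z≢q ∘ ≡-sym)
        ...       | b , Pb , bq , ub = record
          { a = u ; b = b ; a~q = sees Pu Ww uw q∈W (z≢q ∘ ≡-sym) ; b~z = sees Pb q∈W bq z∈W z≢q
          ; a~k = proj₁ Pu ; b~k = proj₁ Pb ; z≁a = uw ∘ near-sym ; q≁b = bq ∘ near-sym ; a≁b = ub
          ; a-only = proj₂ Pu ; b-only = proj₂ Pb }
        result | u , Pu | w , Ww , uw | inj₂ refl with switch Pu Ww uw z∈W z≢q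
        ...       | a , Pa , az , ua = record
          { a = a ; b = u ; a~q = sees Pa z∈W az q∈W (z≢q ∘ ≡-sym) ; b~z = sees Pu Ww uw z∈W z≢q
          ; a~k = proj₁ Pa ; b~k = proj₁ Pu ; z≁a = az ∘ near-sym ; q≁b = uw ∘ near-sym ; a≁b = ua ∘ near-sym
          ; a-only = proj₂ Pa ; b-only = proj₂ Pu }

  -- In the complement, the neighbourhood of k′ inside the common neighbourhood of the remaining
  -- vertices of Out z q is a pentagon, and the vertices found below continue it to an icosahedron,
  -- in which u and k would be antipodal without a common neighbour.
  edgeless : ∀ {z q} → ¬ z ~ q
  edgeless {z} {q} z~q with noPair z q
  ... | k , Kk with noPair z k
  -- The role of `r` is to yield a second vertex `k′` of `K`: both vertices of `W` are near `z`, so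
  -- `r` is near some `k′`, which cannot be `k`.
  ...   | r , ¬zr , ¬kr with Edge.meets z~q r
  ...     | inj₁ Wr = [ (λ { refl → ¬zr (inj₁ refl) }) , (λ { refl → ¬zr (inj₂ z~q) }) ]′ (Edge.W-only z~q Wr)
  ...     | inj₂ (k′ , Kk′ , r-k′) = contradiction
    where
    open Edge z~q
    open Pentagon (pentagon Kk)

    k′≢k : k′ ≢ k
    k′≢k refl = ¬kr (near-sym r-k′)

    far-from-a : ∀ {x} → K x → x ≢ k → ¬ Near a x
    far-from-a = Private.apart Kk (a~k , a-only)

    far-from-b : ∀ {x} → K x → x ≢ k → ¬ Near b x
    far-from-b = Private.apart Kk (b~k , b-only)

    -- As `b` sees only `k` in `K`, `k′` lies outside `z ~ b` too, and there is a pentagon on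
    -- `z ~ b` and `k′`.
    module Z~B = Edge (~-sym b~z)
    open Z~B.Pentagon (Z~B.pentagon (proj₁ Kk′ , far-from-b Kk′ k′≢k))
      using () renaming (b to u; b~z to u~z; b~k to u~k′; b-only to u-only)

    k′≁a : ¬ Near k′ a
    k′≁a = far-from-a Kk′ k′≢k ∘ near-sym

    k′≁k : ¬ Near k′ k
    k′≁k = Private.K-apart Kk Kk′ k′≢k ∘ near-sym

    u∉K : ¬ K u
    u∉K (¬zu , _) = ¬zu (inj₂ (~-sym u~z))

    u≁a : ¬ Near u a
    u≁a (inj₁ u≡a) = z≁a (inj₂ (subst (z ~_) u≡a (~-sym u~z)))
    u≁a (inj₂ u~a) =
      proj₂ Kk′ (inj₂ (subst (q ~_) (u-only (z≁a , a≁b ∘ near-sym) u~a) (~-sym a~q)))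

    -- Otherwise `u ~ k′` and `a ~ k` would be two edges with none between them; `u~q` follows in
    -- the same way from `a ~ q`.
    u~k : u ~ k
    u~k = decidable-stable (u ~? k) λ u≁k →
      noTwo u~k′ a~k u≁a (λ { (inj₁ u≡k) → u∉K (subst K (≡-sym u≡k) Kk) ; (inj₂ e) → u≁k e }) k′≁a k′≁k

    u~q : u ~ q
    u~q = decidable-stable (u ~? q) λ u≁q →
      noTwo u~k′ a~q u≁a (λ { (inj₁ u≡q) → proj₂ Kk′ (inj₂ (subst (_~ k′) u≡q u~k′)) ; (inj₂ e) → u≁q e })
            k′≁a (proj₂ Kk′ ∘ near-sym)

    contradiction : ⊥
    contradiction with dominate (~-sym u~k) u~q (proj₂ Kk ∘ near-sym)
    ... | s , (¬ks , ¬us) , q~s = finish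
      where
      only : ∀ {x} → K x → s ~ x → x ≡ k′
      only {x} Kx s~x = decidable-stable (x ≟ k′) λ x≢k′ →
        noTwo u~k s~x ¬us
          (λ { (inj₁ refl) → u∉K Kx
             ; (inj₂ u~x) → x≢k′ (u-only (proj₁ Kx , far-from-b Kx x≢k) u~x) })
          ¬ks (Private.K-apart Kk Kx x≢k)
        where
        x≢k : x ≢ k
        x≢k refl = ¬ks (inj₂ (~-sym s~x))

      s~k′ : s ~ k′
      s~k′ with meets s
      ... | inj₁ Ws = ⊥-elim ([ (λ { refl → ¬us (inj₂ u~z) }) , (λ { refl → ~-irrefl q~s }) ]′ (W-only Ws))
      ... | inj₂ (_ , Ks , inj₁ refl) = ⊥-elim (proj₂ Ks (inj₂ q~s))
      ... | inj₂ (_ , Kx , inj₂ s~x) with only Kx s~x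
      ...   | refl = s~x

      -- As a private neighbour of `k′`, `s` misses `z` or `q`, and it sees `q`.
      z≁s : ¬ Near z s
      z≁s with Private.missed Kk′ (s~k′ , only)
      ... | _ , Ww , sw with W-only Ww
      ...   | inj₁ refl = sw ∘ near-sym
      ...   | inj₂ refl = ⊥-elim (sw (inj₂ (~-sym q~s)))

      a~s : a ~ s
      a~s = decidable-stable (a ~? s) λ a≁s →
        noTwo s~k′ a~k (λ { (inj₁ refl) → ¬ks (inj₂ (~-sym a~k)) ; (inj₂ e) → a≁s (~-sym e) })
              (¬ks ∘ near-sym) k′≁a k′≁k

      finish : ⊥
      finish = noTwo u~z a~s u≁a ¬us z≁a z≁s

-- The induction on the number of vertices

module _ (Γ : FinGraph) where
  open Basics Γ

  private
    escape? : ∀ x y → Dec (∃ λ r → ¬ Near x r × ¬ Near y r)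
    escape? x y = search λ r → ¬? (near? x r) ×-dec ¬? (near? y r)

    private? : ∀ x w → Dec (∃ λ t → x ~ t × ¬ Near w t)
    private? x w = search λ t → x ~? t ×-dec ¬? (near? w t)

    two-edges? : Dec (∃ λ a → ∃ λ b → ∃ λ c → ∃ λ d → a ~ b × c ~ d ×
                      ¬ Near a c × ¬ Near a d × ¬ Near b c × ¬ Near b d)
    two-edges? = search λ a → search λ b → search λ c → search λ d → a ~? b ×-dec c ~? d ×-dec
      ¬? (near? a c) ×-dec ¬? (near? a d) ×-dec ¬? (near? b c) ×-dec ¬? (near? b d)

    trap? : ∀ o a b p q → Dec (Trap o a b p q)
    trap? o a b p q =
      (a ~? b ×-dec ¬? (near? o a) ×-dec ¬? (near? o b)) ×-dec (near? a p ×-dec near? b q) ×-dec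
      (p ~? q ×-dec ¬? (p ≟ o) ×-dec ¬? (q ≟ o)) ×-dec
      ¬? (search λ t → near? o t ×-dec ¬? (near? p t) ×-dec ¬? (near? q t))

    -- No vertex dominates, so some `r` is not near `p`, and `noCorner` gives `p` a neighbour,
    -- contrary to `edgeless`.
    irreducible : (∀ x y → ∃ λ r → ¬ Near x r × ¬ Near y r) → NoCorner → NoTwoEdges →
                  (∀ {o a b p q} → ¬ Trap o a b p q) → ¬ V
    irreducible noPair noCorner noTwo noTrap p with noPair p p
    ... | r , ¬pr , _ with noCorner {p} {r} (¬pr ∘ inj₁)
    ...   | _ , p~t , _ = Dense.edgeless Γ noTwo noCorner noPair noTrap p~t

  win-by-reductions : Connected′ → P₅-free →
    (∀ Δ → size Δ < size Γ → Basics.Connected′ Δ → Basics.P₅-free Δ → Basics.Win Δ) → Win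
  win-by-reductions conn p5 ih
    with search (λ x → search λ y → ¬? (escape? x y))
       | search (λ x → search λ w → ¬? (x ≟ w) ×-dec ¬? (private? x w))
       | two-edges?
       | search (λ o → search λ a → search λ b → search λ p → search λ q → trap? o a b p q)
  ... | yes (x , y , none) | _ | _ | _ = dominating-pair conn dom
    where
    dom : ∀ r → Near x r ⊎ Near y r
    dom r with near? x r | near? y r
    ... | yes n | _     = inj₁ n
    ... | no _  | yes n = inj₂ n
    ... | no ¬x | no ¬y = ⊥-elim (none (r , ¬x , ¬y))
  ... | no _ | yes (x , w , x≢w , none) | _ | _ = Reductions.corner Γ conn p5 ih x≢w λ {t} x~t →
          decidable-stable (near? w t) λ ¬n → none (t , x~t , ¬n)
  ... | no _ | no _ | yes (_ , _ , _ , _ , a~b , c~d , ac , ad , bc , bd) | _ =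
          Reductions.TwoEdges.win Γ conn p5 ih a~b c~d ac ad bc bd
  ... | no no-pair | no no-corner | no no-two | trap = finish trap
    where
    noPair : ∀ x y → ∃ λ r → ¬ Near x r × ¬ Near y r
    noPair x y = decidable-stable (escape? x y) λ none → no-pair (x , y , none)
    noCorner : NoCorner
    noCorner {x} {w} x≢w = decidable-stable (private? x w) λ none → no-corner (x , w , x≢w , none)
    noTwo : NoTwoEdges
    noTwo e e′ ac ad bc bd = no-two (_ , _ , _ , _ , e , e′ , ac , ad , bc , bd)
    finish : Dec _ → Win
    finish (yes (_ , _ , _ , _ , _ , t)) = Reductions.trap-win Γ conn p5 ih noTwo noCorner t
    finish (no no-trap) p _ _ =
      ⊥-elim (irreducible noPair noCorner noTwo (λ t → no-trap (_ , _ , _ , _ , _ , t)) p)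

two-cops-win : ∀ Γ → Basics.Connected′ Γ → Basics.P₅-free Γ → Basics.Win Γ
two-cops-win Γ = below (suc (size Γ)) Γ ≤-refl
  where
  below : ∀ m Γ → size Γ < m → Basics.Connected′ Γ → Basics.P₅-free Γ → Basics.Win Γ
  below (suc m) Γ small conn p5 =
    win-by-reductions Γ conn p5 λ Δ Δ<Γ → below m Δ (≤-trans Δ<Γ (≤-pred small))

-- Translation to the given definitions

module FromGraph {n : ℕ} (G : Graph n) where

  finGraph : FinGraph
  finGraph = record
    { V        = Fin n
    ; _~_      = Adj G
    ; _~?_     = adj? G
    ; ~-sym    = sym G
    ; ~-irrefl = irrefl G
    ; _≟_      = Fin._≟_
    ; vertices = allFin n
    ; complete = ∈-allFin
    }

  open Basics finGraph

  connected : Connected G → Connected′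
  connected conn {u} {v} _ _ = walk (conn u v)
    where
    walk : ∀ {u v} → Reach G u v → Walk Everywhere u v
    walk here       = stop tt
    walk (step e w) = Basics.step tt e (walk w)

  p5Adj? : ∀ i j → Dec (P5Adj i j)
  p5Adj? i j = (suc (toℕ i) ℕ.≟ toℕ j) ⊎-dec (suc (toℕ j) ℕ.≟ toℕ i)

  -- This makes the embedding `f` injective; the decision procedure verifies it by evaluation.
  p5-twin-free : ∀ i j → i ≡ j ⊎ ∃ λ k → (P5Adj i k × ¬ P5Adj j k) ⊎ (P5Adj j k × ¬ P5Adj i k)
  p5-twin-free = toWitness {a? = Fin.all? λ i → Fin.all? λ j → (i Fin.≟ j) ⊎-dec
    Fin.any? λ k → (p5Adj? i k ×-dec ¬? (p5Adj? j k)) ⊎-dec (p5Adj? j k ×-dec ¬? (p5Adj? i k))} tt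

  p₅-free : P5Free G → P₅-free
  p₅-free free a b c d e ab bc cd de ac ad ae bd be ce = free (f , injective , f-adj)
    where
    f : Fin 5 → Fin n
    f zero                         = a
    f (suc zero)                   = b
    f (suc (suc zero))             = c
    f (suc (suc (suc zero)))       = d
    f (suc (suc (suc (suc zero)))) = e

    f-adj : ∀ i j → Adj G (f i) (f j) ⇔ P5Adj i j
    f-adj zero zero = mk⇔ (⊥-elim ∘ (irrefl G)) (λ { (inj₁ ()) ; (inj₂ ()) })
    f-adj zero (suc zero) = mk⇔ (λ _ → inj₁ refl) (λ _ → ab)
    f-adj zero (suc (suc zero)) = mk⇔ (⊥-elim ∘ ac) (λ { (inj₁ ()) ; (inj₂ ()) })
    f-adj zero (suc (suc (suc zero))) = mk⇔ (⊥-elim ∘ ad) (λ { (inj₁ ()) ; (inj₂ ()) })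
    f-adj zero (suc (suc (suc (suc zero)))) = mk⇔ (⊥-elim ∘ ae) (λ { (inj₁ ()) ; (inj₂ ()) })
    f-adj (suc zero) zero = mk⇔ (λ _ → inj₂ refl) (λ _ → sym G ab)
    f-adj (suc zero) (suc zero) = mk⇔ (⊥-elim ∘ (irrefl G)) (λ { (inj₁ ()) ; (inj₂ ()) })
    f-adj (suc zero) (suc (suc zero)) = mk⇔ (λ _ → inj₁ refl) (λ _ → bc)
    f-adj (suc zero) (suc (suc (suc zero))) = mk⇔ (⊥-elim ∘ bd) (λ { (inj₁ ()) ; (inj₂ ()) })
    f-adj (suc zero) (suc (suc (suc (suc zero)))) = mk⇔ (⊥-elim ∘ be) (λ { (inj₁ ()) ; (inj₂ ()) })
    f-adj (suc (suc zero)) zero = mk⇔ (⊥-elim ∘ (ac ∘ sym G)) (λ { (inj₁ ()) ; (inj₂ ()) })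
    f-adj (suc (suc zero)) (suc zero) = mk⇔ (λ _ → inj₂ refl) (λ _ → sym G bc)
    f-adj (suc (suc zero)) (suc (suc zero)) = mk⇔ (⊥-elim ∘ (irrefl G)) (λ { (inj₁ ()) ; (inj₂ ()) })
    f-adj (suc (suc zero)) (suc (suc (suc zero))) = mk⇔ (λ _ → inj₁ refl) (λ _ → cd)
    f-adj (suc (suc zero)) (suc (suc (suc (suc zero)))) = mk⇔ (⊥-elim ∘ ce) (λ { (inj₁ ()) ; (inj₂ ()) })
    f-adj (suc (suc (suc zero))) zero = mk⇔ (⊥-elim ∘ (ad ∘ sym G)) (λ { (inj₁ ()) ; (inj₂ ()) })
    f-adj (suc (suc (suc zero))) (suc zero) = mk⇔ (⊥-elim ∘ (bd ∘ sym G)) (λ { (inj₁ ()) ; (inj₂ ()) })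
    f-adj (suc (suc (suc zero))) (suc (suc zero)) = mk⇔ (λ _ → inj₂ refl) (λ _ → sym G cd)
    f-adj (suc (suc (suc zero))) (suc (suc (suc zero))) = mk⇔ (⊥-elim ∘ (irrefl G)) (λ { (inj₁ ()) ; (inj₂ ()) })
    f-adj (suc (suc (suc zero))) (suc (suc (suc (suc zero)))) = mk⇔ (λ _ → inj₁ refl) (λ _ → de)
    f-adj (suc (suc (suc (suc zero)))) zero = mk⇔ (⊥-elim ∘ (ae ∘ sym G)) (λ { (inj₁ ()) ; (inj₂ ()) })
    f-adj (suc (suc (suc (suc zero)))) (suc zero) = mk⇔ (⊥-elim ∘ (be ∘ sym G)) (λ { (inj₁ ()) ; (inj₂ ()) })
    f-adj (suc (suc (suc (suc zero)))) (suc (suc zero)) = mk⇔ (⊥-elim ∘ (ce ∘ sym G)) (λ { (inj₁ ()) ; (inj₂ ()) })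
    f-adj (suc (suc (suc (suc zero)))) (suc (suc (suc zero))) = mk⇔ (λ _ → inj₂ refl) (λ _ → sym G de)
    f-adj (suc (suc (suc (suc zero)))) (suc (suc (suc (suc zero)))) = mk⇔ (⊥-elim ∘ (irrefl G)) (λ { (inj₁ ()) ; (inj₂ ()) })

    injective : ∀ {i j} → f i ≡ f j → i ≡ j
    injective {i} {j} eq with p5-twin-free i j
    ... | inj₁ i≡j = i≡j
    ... | inj₂ (k , inj₁ (ik , ¬jk)) =
      ⊥-elim (¬jk (to (f-adj j k) (subst (λ x → Adj G x (f k)) eq (from (f-adj i k) ik))))
    ... | inj₂ (k , inj₂ (jk , ¬ik)) =
      ⊥-elim (¬ik (to (f-adj i k) (subst (λ x → Adj G x (f k)) (≡-sym eq) (from (f-adj j k) jk))))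

  cops : Fin n → Fin n → Fin 2 → Fin n
  cops p q zero       = p
  cops p q (suc zero) = q

  moves : ∀ {p q p′ q′} → Near p p′ → Near q q′ → ∀ i → Move G (cops p q i) (cops p′ q′ i)
  moves m n zero       = m
  moves m n (suc zero) = n

  winC : ∀ {p q r} → WinC p q r → CopWinC G (cops p q) r
  winR : ∀ {p q r} → WinR p q r → CopWinR G (cops p q) r
  winC (grab₁ n)  = moveC (cops _ _) (moves n (inj₁ refl)) (caughtR (zero , refl))
  winC (grab₂ n)  = moveC (cops _ _) (moves (inj₁ refl) n) (caughtR (suc zero , refl))
  winC (go m n w) = moveC (cops _ _) (moves m n) (winR w)
  winR (wait h)   = moveR λ r′ m → winC (h r′ m)

theorem1p1 : (n : ℕ) (G : Graph n) → Connected G → P5Free G → CopNumber≤ G 2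
-- On the empty graph two cops have nowhere to stand, so no cop is used.
theorem1p1 zero    G conn free = 0 , z≤n , (λ ()) , λ ()
theorem1p1 (suc n) G conn free = 2 , ≤-refl , cops zero zero , λ r →
  winC (two-cops-win finGraph (connected conn) (p₅-free free) zero zero r)
  where open FromGraph G
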